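{- The logic $\mathsf{CS4}$ has the finite frame property: for every formula $\varphi$ of the language $\mathcal L$, if $\varphi$ is falsifiable on some $\mathsf{CS4}$ frame, then $\varphi$ is falsifiable on some finite $\mathsf{CS4}$ frame; and if $\varphi$ is satisfiable on some $\mathsf{CS4}$ frame, then $\varphi$ is satisfiable on some finite $\mathsf{CS4}$ frame.
   Context: Fix a countably infinite set $\mathbb P$ of propositional variables. The language $\mathcal L$ is given by $\varphi ::= p \mid \bot \mid (\varphi\wedge\varphi)\mid(\varphi\vee\varphi)\mid(\varphi\to\varphi)\mid\Diamond\varphi\mid\Box\varphi$ with $p\in\mathbb P$. A bi-intuitionistic frame is a tuple $\mathcal F=(W,W^\bot,\preccurlyeq,\sqsubseteq)$ where $W$ is a set, $\preccurlyeq$ and $\sqsubseteq$ are preorders (reflexive and transitive relations) on $W$, and $W^\bot\subseteq W$ (the fallible worlds) is closed upward under both $\preccurlyeq$ and $\sqsubseteq$. The frame is back--up confluent if whenever $w\sqsubseteq v\preccurlyeq v'$ there is $w'$ with $w\preccurlyeq w'\sqsubseteq v'$. A $\mathsf{CS4}$ frame is a back--up confluent bi-intuitionistic frame. A valuation on $\mathcal F$ is a map $V:\mathbb P\to 2^W$ such that each $V(p)$ is upward closed under $\preccurlyeq$ and contains $W^\bot$; $\mathcal M=(\mathcal F,V)$ is a model. Satisfaction: $(\mathcal M,w)\models p$ iff $w\in V(p)$; $(\mathcal M,w)\models\bot$ iff $w\in W^\bot$; $\wedge,\vee$ are pointwise; $(\mathcal M,w)\models\varphi\to\psi$ iff for all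 $v$ with $w\preccurlyeq v$, $(\mathcal M,v)\models\varphi$ implies $(\mathcal M,v)\models\psi$; $(\mathcal M,w)\models\Diamond\varphi$ iff for all $u$ with $w\preccurlyeq u$ there is $v$ with $u\sqsubseteq v$ and $(\mathcal M,v)\models\varphi$; $(\mathcal M,w)\models\Box\varphi$ iff for all $u,v$ with $w\preccurlyeq u\sqsubseteq v$, $(\mathcal M,v)\models\varphi$. A formula $\varphi$ is falsifiable on a frame $\mathcal F$ if there is a valuation $V$ on $\mathcal F$ and a world $w\in W\setminus W^\bot$ with $((\mathcal F,V),w)\not\models\varphi$; it is satisfiable on $\mathcal F$ if there is a valuation $V$ and $w\in W\setminus W^\bot$ with $((\mathcal F,V),w)\models\varphi$. A frame is finite if $W$ is finite. -}

module Defs where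

open import Data.Nat using (ℕ)
open import Data.Fin using (Fin)
open import Data.Product using (Σ; ∃; _×_; _,_)
open import Data.Sum using (_⊎_)
open import Relation.Nullary using (¬_)
open import Function.Bundles using (_↔_)

PVar : Set
PVar = ℕ

infixr 5 _⇒_
infixr 6 _∨_
infixr 7 _∧_

data Form : Set where
  var  : PVar → Form
  ⊥'   : Form
  _∧_  : Form → Form → Form
  _∨_  : Form → Form → Form
  _⇒_  : Form → Form → Form
  ◇    : Form → Form
  □    : Form → Form

record BiIntFrame : Set₁ where
  field
    W       : Set
    Fall    : W → Set
    _≼_     : W → W → Set
    _⊑_     : W → W → Set
    ≼-refl  : ∀ {w} → w ≼ w
    ≼-trans : ∀ {u v w} → u ≼ v → v ≼ w → u ≼ w
    ⊑-refl  : ∀ {w} → w ⊑ w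
    ⊑-trans : ∀ {u v w} → u ⊑ v → v ⊑ w → u ⊑ w
    Fall-≼  : ∀ {w v} → w ≼ v → Fall w → Fall v
    Fall-⊑  : ∀ {w v} → w ⊑ v → Fall w → Fall v

open BiIntFrame public

BackUpConfluent : BiIntFrame → Set
BackUpConfluent F =
  ∀ {w v v'} → _⊑_ F w v → _≼_ F v v' →
  Σ (W F) λ w' → _≼_ F w w' × _⊑_ F w' v'

record CS4Frame : Set₁ where
  field
    frame    : BiIntFrame
    backUpConf : BackUpConfluent frame

open CS4Frame public

record Valuation (F : BiIntFrame) : Set₁ where
  field
    val      : PVar → W F → Set
    val-≼    : ∀ p {w v} → _≼_ F w v → val p w → val p v
    val-Fall : ∀ p {w} → Fall F w → val p w

open Valuation public

Sat : (F : BiIntFrame) → Valuation F → W F → Form → Set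
Sat F V w (var p)   = val V p w
Sat F V w ⊥'        = Fall F w
Sat F V w (φ ∧ ψ)   = Sat F V w φ × Sat F V w ψ
Sat F V w (φ ∨ ψ)   = Sat F V w φ ⊎ Sat F V w ψ
Sat F V w (φ ⇒ ψ)   = ∀ v → _≼_ F w v → Sat F V v φ → Sat F V v ψ
Sat F V w (◇ φ)     = ∀ u → _≼_ F w u → Σ (W F) λ v → _⊑_ F u v × Sat F V v φ
Sat F V w (□ φ)     = ∀ u v → _≼_ F w u → _⊑_ F u v → Sat F V v φ

Falsifiable : BiIntFrame → Form → Set₁
Falsifiable F φ =
  Σ (Valuation F) λ V → Σ (W F) λ w → ¬ Fall F w × ¬ Sat F V w φ

Satisfiable : BiIntFrame → Form → Set₁
Satisfiable F φ =
  Σ (Valuation F) λ V → Σ (W F) λ w → ¬ Fall F w × Sat F V w φ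

Finite : BiIntFrame → Set
Finite F = Σ ℕ λ n → Fin n ↔ W F

{-# OPTIONS --safe #-}

-- A finite canonical model.  A world is a sequent Γ ⊢ Δ ∣ Θ, where Γ and Δ split
-- the subformulas of φ into those forced and those not forced, and Θ is at most
-- one formula that is moreover not forced at any ⊑-successor; its interpretation
-- is Γ ⊨ Δ, ◇Θ.  The order ≼ is inclusion of Γ, and forgets Θ; the relation ⊑
-- preserves ⊥, the boxed formulas of Γ, and Θ.  Confluence holds because
-- Γ ⊢ Δ ∣ Θ ≼ Γ ⊢ Δ ∣ ∅ ⊑ v' as soon as the boxed formulas of Γ belong to v'.
--
-- To stay constructive, the worlds are found by elimination instead of by
-- maximal consistent extension: starting from all sequents, delete those that
-- lack a witness required by the truth lemma.  Each deleted sequent is valid in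
-- every model, since intuitionistic forcing admits a multi-conclusion cut at a
-- single world.  So a sequent is either valid or refuted in the finite model.
module Submission where

open import Defs
open import Data.Nat using (ℕ; zero; suc; _≤_; _<_; s≤s)
open import Data.Nat.Properties using (≤-refl; ≤-trans) renaming (_≟_ to _≟ℕ_)
open import Data.Fin using (Fin)
open import Data.Product using (Σ; ∃; _×_; _,_; proj₁; proj₂)
open import Data.Sum using (_⊎_; inj₁; inj₂; [_,_]′)
open import Data.Sum as Sum using ()
open import Data.Unit using (⊤; tt)
open import Data.Maybe using (Maybe; just; nothing)
open import Data.Maybe.Properties using (≡-dec)
open import Data.Maybe.Relation.Unary.Any using (just) renaming (Any to MAny)
open import Data.List using (List; []; _∷_; _++_; length; map; filter; lookup; cartesianProductWith)
open import Data.List.Relation.Unary.All as All using (All; []; _∷_)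
open import Data.List.Relation.Unary.Any as Any using (Any; here; there; any?; index)
open import Data.List.Relation.Unary.Any.Properties using (lookup-index)
open import Data.List.Membership.Propositional using (_∈_; _∉_; lose)
open import Data.List.Membership.Propositional.Properties
  using (∈-++⁺ˡ; ∈-++⁺ʳ; ∈-++⁻; ∈-map⁺; ∈-map⁻; ∈-filter⁺; ∈-filter⁻; ∈-lookup;
         ∈-cartesianProductWith⁺; ∈-cartesianProductWith⁻)
open import Data.List.Relation.Binary.Subset.Propositional using (_⊆_)
open import Data.List.Relation.Binary.Subset.Propositional.Properties using (filter-⊆; ∈-∷⁺ʳ)
import Data.List.Relation.Binary.Subset.DecPropositional as DecSubset
open import Function using (_∘_; id)
open import Function.Construct.Identity using (↔-id)
open import Level using (Level)
open import Relation.Nullary using (¬_; Dec; yes; no; contradiction)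
open import Relation.Nullary.Decidable using (map′; _×-dec_)
open import Relation.Binary.Definitions using (DecidableEquality)
open import Relation.Binary.PropositionalEquality using (_≡_; refl; sym; trans; cong; cong₂; subst)

private
  variable
    a p q : Level
    A     : Set a
    φ ψ   : Form

-- Formulas: decidable equality and subformulas

-- Trees tagged by the number of the connective: equality is then decided on two constructors
-- instead of on every pair of connectives.
data Code : Set where
  leaf : ℕ → Code
  node : ℕ → Code → Code → Code

encode : Form → Code
encode ⊥'      = leaf 0
encode (var n) = leaf (suc n)
encode (φ ∧ ψ) = node 0 (encode φ) (encode ψ)
encode (φ ∨ ψ) = node 1 (encode φ) (encode ψ)
encode (φ ⇒ ψ) = node 2 (encode φ) (encode ψ)
encode (◇ φ)   = node 3 (encode φ) (leaf 0)
encode (□ φ)   = node 4 (encode φ) (leaf 0)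

decode : Code → Form
decode (leaf 0)       = ⊥'
decode (leaf (suc n)) = var n
decode (node 0 c d)   = decode c ∧ decode d
decode (node 1 c d)   = decode c ∨ decode d
decode (node 2 c d)   = decode c ⇒ decode d
decode (node 3 c d)   = ◇ (decode c)
-- Tags above 4 are junk and decode as boxes; only images of `encode` matter.
decode (node _ c d)   = □ (decode c)

decode-encode : ∀ φ → decode (encode φ) ≡ φ
decode-encode ⊥'      = refl
decode-encode (var n) = refl
decode-encode (φ ∧ ψ) = cong₂ _∧_ (decode-encode φ) (decode-encode ψ)
decode-encode (φ ∨ ψ) = cong₂ _∨_ (decode-encode φ) (decode-encode ψ)
decode-encode (φ ⇒ ψ) = cong₂ _⇒_ (decode-encode φ) (decode-encode ψ)
decode-encode (◇ φ)   = cong ◇ (decode-encode φ)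
decode-encode (□ φ)   = cong □ (decode-encode φ)

encode-injective : encode φ ≡ encode ψ → φ ≡ ψ
encode-injective {φ} {ψ} eq =
  trans (sym (decode-encode φ)) (trans (cong decode eq) (decode-encode ψ))

_≟ᶜ_ : DecidableEquality Code
leaf m       ≟ᶜ leaf n          = map′ (cong leaf) (λ { refl → refl }) (m ≟ℕ n)
leaf _       ≟ᶜ node _ _ _      = no λ ()
node _ _ _   ≟ᶜ leaf _          = no λ ()
node m c₁ c₂ ≟ᶜ node n d₁ d₂ =
  map′ (λ { (refl , refl , refl) → refl }) (λ { refl → refl , refl , refl })
       ((m ≟ℕ n) ×-dec (c₁ ≟ᶜ d₁) ×-dec (c₂ ≟ᶜ d₂))

_≟_ : DecidableEquality Form
φ ≟ ψ = map′ encode-injective (cong encode) (encode φ ≟ᶜ encode ψ)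

open DecSubset _≟_ using (_⊆?_)

children : Form → List Form
children (φ ∧ ψ) = φ ∷ ψ ∷ []
children (φ ∨ ψ) = φ ∷ ψ ∷ []
children (φ ⇒ ψ) = φ ∷ ψ ∷ []
children (◇ φ)   = φ ∷ []
children (□ φ)   = φ ∷ []
children _       = []

Closed : List Form → Set
Closed σ = ∀ {φ} → φ ∈ σ → children φ ⊆ σ

subformulas : Form → List Form
subformulas (φ ∧ ψ) = φ ∧ ψ ∷ subformulas φ ++ subformulas ψ
subformulas (φ ∨ ψ) = φ ∨ ψ ∷ subformulas φ ++ subformulas ψ
subformulas (φ ⇒ ψ) = (φ ⇒ ψ) ∷ subformulas φ ++ subformulas ψ
subformulas (◇ φ)   = ◇ φ ∷ subformulas φ
subformulas (□ φ)   = □ φ ∷ subformulas φ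
subformulas (var n) = var n ∷ []
subformulas ⊥'      = ⊥' ∷ []

∈-subformulas : ∀ φ → φ ∈ subformulas φ
∈-subformulas (var n) = here refl
∈-subformulas ⊥'      = here refl
∈-subformulas (φ ∧ ψ) = here refl
∈-subformulas (φ ∨ ψ) = here refl
∈-subformulas (φ ⇒ ψ) = here refl
∈-subformulas (◇ φ)   = here refl
∈-subformulas (□ φ)   = here refl

closed-∷ : ∀ {σ} → children φ ⊆ σ → Closed σ → Closed (φ ∷ σ)
closed-∷ root clo (here refl) = there ∘ root
closed-∷ root clo (there m)   = there ∘ clo m

closed-++ : ∀ {σ τ} → Closed σ → Closed τ → Closed (σ ++ τ)
closed-++ {σ} cloσ cloτ m with ∈-++⁻ σ m
... | inj₁ m₁ = ∈-++⁺ˡ ∘ cloσ m₁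
... | inj₂ m₂ = ∈-++⁺ʳ σ ∘ cloτ m₂

operands⊆ : ∀ φ ψ → φ ∷ ψ ∷ [] ⊆ subformulas φ ++ subformulas ψ
operands⊆ φ ψ = ∈-∷⁺ʳ (∈-++⁺ˡ (∈-subformulas φ))
               (∈-∷⁺ʳ (∈-++⁺ʳ (subformulas φ) (∈-subformulas ψ)) λ ())

subformulas-closed : ∀ φ → Closed (subformulas φ)
subformulas-closed (var n) = closed-∷ (λ ()) (λ ())
subformulas-closed ⊥'      = closed-∷ (λ ()) (λ ())
subformulas-closed (φ ∧ ψ) =
  closed-∷ (operands⊆ φ ψ) (closed-++ (subformulas-closed φ) (subformulas-closed ψ))
subformulas-closed (φ ∨ ψ) =
  closed-∷ (operands⊆ φ ψ) (closed-++ (subformulas-closed φ) (subformulas-closed ψ))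
subformulas-closed (φ ⇒ ψ) =
  closed-∷ (operands⊆ φ ψ) (closed-++ (subformulas-closed φ) (subformulas-closed ψ))
subformulas-closed (◇ φ) =
  closed-∷ (∈-∷⁺ʳ (∈-subformulas φ) λ ()) (subformulas-closed φ)
subformulas-closed (□ φ) =
  closed-∷ (∈-∷⁺ʳ (∈-subformulas φ) λ ()) (subformulas-closed φ)

data Persistent : Form → Set where
  falsum : Persistent ⊥'
  box    : Persistent (□ φ)

persistent? : ∀ φ → Dec (Persistent φ)
persistent? ⊥'      = yes falsum
persistent? (□ φ)   = yes box
persistent? (var n) = no λ ()
persistent? (φ ∧ ψ) = no λ ()
persistent? (φ ∨ ψ) = no λ ()
persistent? (φ ⇒ ψ) = no λ ()
persistent? (◇ φ)   = no λ ()

persistents : List Form → List Form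
persistents = filter persistent?

-- Lists

all-or : {P : A → Set p} {Q : Set q} → ∀ xs →
         (∀ {x} → x ∈ xs → P x ⊎ Q) → All P xs ⊎ Q
all-or []       f = inj₁ []
all-or (x ∷ xs) f with f (here refl) | all-or xs (f ∘ there)
... | inj₁ px | inj₁ pxs = inj₁ (px ∷ pxs)
... | inj₁ _  | inj₂ y   = inj₂ y
... | inj₂ y  | _        = inj₂ y

-- One round of elimination: the strict drop in length is the termination measure, and every dropped
-- entry satisfies `Q`.
all-or-shrink : {P : A → Set p} {Q : A → Set q} → ∀ xs →
  (∀ {x} → x ∈ xs → P x ⊎ Q x) →
  All P xs ⊎ ∃ λ ys → length ys < length xs × ys ⊆ xs × (∀ {x} → x ∈ xs → x ∈ ys ⊎ Q x)
all-or-shrink []       f = inj₁ []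
all-or-shrink (x ∷ xs) f with f (here refl) | all-or-shrink xs (f ∘ there)
... | inj₂ qx | _        =
  inj₂ (xs , ≤-refl , there , λ { (here refl) → inj₂ qx ; (there m) → inj₁ m })
... | inj₁ px | inj₁ pxs = inj₁ (px ∷ pxs)
... | inj₁ px | inj₂ (ys , lt , sub , cov) =
  inj₂ (x ∷ ys , s≤s lt , (λ { (here e) → here e ; (there m) → there (sub m) }) ,
        λ { (here e) → inj₁ (here e) ; (there m) → Sum.map₁ there (cov m) })

-- The choice is made per position, so an entry repeated in the list can land on both sides; hence
-- the field `disjoint` of `Good`.
splits : List A → List (List A × List A)
splits []       = ([] , []) ∷ []
splits (x ∷ xs) = map (λ (l , r) → x ∷ l , r) (splits xs)
               ++ map (λ (l , r) → l , x ∷ r) (splits xs)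

splits-cover : ∀ (xs : List A) {l r x} → (l , r) ∈ splits xs → x ∈ xs → x ∈ l ⊎ x ∈ r
splits-cover (y ∷ ys) m x∈ with ∈-++⁻ (map _ (splits ys)) m
... | inj₁ m₁ with ∈-map⁻ _ m₁ | x∈
...   | _ , m′ , refl | here e   = inj₁ (here e)
...   | _ , m′ , refl | there x∈ys = Sum.map₁ there (splits-cover ys m′ x∈ys)
splits-cover (y ∷ ys) m x∈ | inj₂ m₂ with ∈-map⁻ _ m₂ | x∈
...   | _ , m′ , refl | here e   = inj₂ (here e)
...   | _ , m′ , refl | there x∈ys = Sum.map₂ there (splits-cover ys m′ x∈ys)

splits-⊆ : ∀ (xs : List A) {l r} → (l , r) ∈ splits xs → l ⊆ xs × r ⊆ xs
splits-⊆ []       (here refl) = id , id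
splits-⊆ (y ∷ ys) m with ∈-++⁻ (map _ (splits ys)) m
... | inj₁ m₁ with ∈-map⁻ _ m₁
...   | _ , m′ , refl with l⊆ , r⊆ ← splits-⊆ ys m′ =
  ∈-∷⁺ʳ (here refl) (there ∘ l⊆) , there ∘ r⊆
splits-⊆ (y ∷ ys) m | inj₂ m₂ with ∈-map⁻ _ m₂
...   | _ , m′ , refl with l⊆ , r⊆ ← splits-⊆ ys m′ =
  there ∘ l⊆ , ∈-∷⁺ʳ (here refl) (there ∘ r⊆)

-- Iterated cut: no decidability of P is needed, because P x is only ever obtained
-- as one of the disjuncts of a conclusion.
cut : {P : A → Set p} {C : Set q} → ∀ xs →
  (∀ {l r} → (l , r) ∈ splits xs → All P l → Any P r ⊎ C) → C
cut [] h with h (here refl) []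
... | inj₂ c = c
cut {P = P} {C = C} (x ∷ xs) h
  -- First `x` is placed on the right, with `P x` moved into the conclusion; if `P x` comes out, a
  -- second pass places `x` on the left.
  with cut {C = C ⊎ P x} xs (λ m ps → defer (h (∈-++⁺ʳ (map _ (splits xs)) (∈-map⁺ _ m)) ps))
  where
  defer : ∀ {r} → Any P (x ∷ r) ⊎ C → Any P r ⊎ (C ⊎ P x)
  defer (inj₁ (here px)) = inj₂ (inj₂ px)
  defer (inj₁ (there a)) = inj₁ a
  defer (inj₂ c)         = inj₂ (inj₁ c)
... | inj₁ c  = c
... | inj₂ px = cut xs λ m ps → h (∈-++⁺ˡ (∈-map⁺ _ m)) (px ∷ ps)

-- Persistence of satisfaction

module _ {F : BiIntFrame} (V : Valuation F) where

  Sat-≼ : ∀ φ {w v} → _≼_ F w v → Sat F V w φ → Sat F V v φ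
  Sat-≼ (var n) w≼v s         = val-≼ V n w≼v s
  Sat-≼ ⊥'      w≼v s         = Fall-≼ F w≼v s
  Sat-≼ (φ ∧ ψ) w≼v (s , t)   = Sat-≼ φ w≼v s , Sat-≼ ψ w≼v t
  Sat-≼ (φ ∨ ψ) w≼v           = Sum.map (Sat-≼ φ w≼v) (Sat-≼ ψ w≼v)
  Sat-≼ (φ ⇒ ψ) w≼v s u v≼u   = s u (≼-trans F w≼v v≼u)
  Sat-≼ (◇ φ)   w≼v s u v≼u   = s u (≼-trans F w≼v v≼u)
  Sat-≼ (□ φ)   w≼v s u t v≼u = s u t (≼-trans F w≼v v≼u)

  All-Sat-≼ : ∀ {Γ w v} → _≼_ F w v → All (Sat F V w) Γ → All (Sat F V v) Γ
  All-Sat-≼ w≼v = All.map λ {φ} → Sat-≼ φ w≼v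

  Sat-Fall : ∀ φ {w} → Fall F w → Sat F V w φ
  Sat-Fall (var n) f             = val-Fall V n f
  Sat-Fall ⊥'      f             = f
  Sat-Fall (φ ∧ ψ) f             = Sat-Fall φ f , Sat-Fall ψ f
  Sat-Fall (φ ∨ ψ) f             = inj₁ (Sat-Fall φ f)
  Sat-Fall (φ ⇒ ψ) f v w≼v _     = Sat-Fall ψ (Fall-≼ F w≼v f)
  Sat-Fall (◇ φ)   f u w≼u       = u , ⊑-refl F , Sat-Fall φ (Fall-≼ F w≼u f)
  Sat-Fall (□ φ)   f u v w≼u u⊑v = Sat-Fall φ (Fall-⊑ F u⊑v (Fall-≼ F w≼u f))

  -- For a box, confluence reroutes `w ⊑ v ≼ u ⊑ t` as `w ≼ w′ ⊑ u ⊑ t`; for falsum, fallibility is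
  -- closed under `⊑`.
  Sat-persistents-⊑ : BackUpConfluent F → ∀ {w v} → _⊑_ F w v → ∀ Γ →
    All (Sat F V w) Γ → All (Sat F V v) (persistents Γ)
  Sat-persistents-⊑ conf {w} {v} w⊑v Γ ⊨Γ = All.tabulate λ m →
    let φ∈Γ , per = ∈-filter⁻ persistent? {xs = Γ} m in go per (All.lookup ⊨Γ φ∈Γ)
    where
    go : Persistent φ → Sat F V w φ → Sat F V v φ
    go falsum f = Fall-⊑ F w⊑v f
    go box s u t v≼u u⊑t with w′ , w≼w′ , w′⊑u ← conf w⊑v v≼u =
      s w′ t w≼w′ (⊑-trans F w′⊑u u⊑t)

  -- For `just θ` this collapses ◇◇θ to ◇θ by transitivity of `⊑`; for `nothing` the hypothesis at
  -- `w` itself is absurd.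
  ◇-transitive : ∀ {w Θ} →
    (∀ u → _≼_ F w u → ∃ λ v → _⊑_ F u v × MAny (Sat F V v ∘ ◇) Θ) → MAny (Sat F V w ∘ ◇) Θ
  ◇-transitive {w} {nothing} h with _ , _ , () ← h w (≼-refl F)
  ◇-transitive {w} {just θ}  h = just λ u w≼u → compose u (h u w≼u)
    where
    compose : ∀ u → ∃ (λ v → _⊑_ F u v × MAny (Sat F V v ∘ ◇) (just θ)) →
      ∃ λ v → _⊑_ F u v × Sat F V v θ
    compose u (v , u⊑v , just ◇θ) with v′ , v⊑v′ , ⊨θ ← ◇θ v (≼-refl F) =
      v′ , ⊑-trans F u⊑v v⊑v′ , ⊨θ

-- Sequents

infix 4 _⊢_∣_

record Sequent : Set where
  constructor _⊢_∣_
  field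
    ante succ : List Form
    later     : Maybe Form

open Sequent

Valid : Sequent → Set₁
Valid s = ∀ (F : CS4Frame) (V : Valuation (frame F)) w →
  All (Sat (frame F) V w) (ante s) →
  Any (Sat (frame F) V w) (succ s) ⊎ MAny (Sat (frame F) V w ∘ ◇) (later s)

-- A source whose `later` is `nothing` sees every sequent containing its persistent formulas,
-- whatever the target's `later` is.
_⊑ˢ_ : Sequent → Sequent → Set
s ⊑ˢ t = persistents (ante s) ⊆ ante t × (later s ≡ nothing ⊎ later s ≡ later t)

⊑ˢ-trans : ∀ {s t u} → s ⊑ˢ t → t ⊑ˢ u → s ⊑ˢ u
⊑ˢ-trans {s} (p , l) (q , m) =
  (λ {_} x → q (∈-filter⁺ persistent? (p x) (proj₂ (∈-filter⁻ persistent? {xs = ante s} x)))) ,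
  compose l m
  where
  compose : ∀ {a b c : Maybe Form} → a ≡ nothing ⊎ a ≡ b → b ≡ nothing ⊎ b ≡ c → a ≡ nothing ⊎ a ≡ c
  compose (inj₁ e)    _ = inj₁ e
  compose (inj₂ refl) m = m

Extends : Sequent → Sequent → Set
Extends s t = ante s ⊆ ante t × succ s ⊆ succ t × later s ≡ later t

-- What a world s needs from the set L of worlds for the truth lemma to hold at a
-- formula of its antecedent or succedent.

Forced : List Sequent → Sequent → Form → Set
Forced L s (φ ∧ ψ) = φ ∈ ante s × ψ ∈ ante s
Forced L s (φ ∨ ψ) = φ ∈ ante s ⊎ ψ ∈ ante s
-- From here on the demands are local to `s`: a world above `s` inherits the formula and meets the
-- same demand itself.
Forced L s (φ ⇒ ψ) = φ ∈ succ s ⊎ ψ ∈ ante s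
Forced L s (◇ φ)   = Any (λ t → s ⊑ˢ t × φ ∈ ante t) L
Forced L s (□ φ)   = φ ∈ ante s
Forced L s _       = ⊤

Refuted : List Sequent → Sequent → Form → Set
Refuted L s (φ ∧ ψ) = φ ∈ succ s ⊎ ψ ∈ succ s
Refuted L s (φ ∨ ψ) = φ ∈ succ s × ψ ∈ succ s
Refuted L s (φ ⇒ ψ) = Any (λ t → ante s ⊆ ante t × φ ∈ ante t × ψ ∈ succ t) L
Refuted L s (◇ φ)   = Any (λ t → ante s ⊆ ante t × later t ≡ just φ) L
Refuted L s (□ φ)   = Any (λ t → persistents (ante s) ⊆ ante t × φ ∈ succ t) L
Refuted L s _       = ⊤

-- `infallible` lets a world contain ⊥ only when it refutes nothing. `later-succ` reflects
-- reflexivity of `⊑`: a formula refuted at all successors is refuted at `s`. `base` supplies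
-- confluence.
record Good (L : List Sequent) (s : Sequent) : Set where
  field
    forced     : All (Forced L s) (ante s)
    refuted    : All (Refuted L s) (succ s)
    disjoint   : All (_∉ ante s) (succ s)
    infallible : All (λ _ → ⊥' ∉ ante s) (succ s)
    later-succ : ∀ {φ} → later s ≡ just φ → φ ∈ succ s
    base       : (ante s ⊢ succ s ∣ nothing) ∈ L

-- Elimination of valid sequents

module Elimination (σ : List Form) (closed : Closed σ) where

  laters : List (Maybe Form)
  laters = nothing ∷ map just σ

  candidates : List Sequent
  candidates = cartesianProductWith (λ (Γ , Δ) Θ → Γ ⊢ Δ ∣ Θ) (splits σ) laters

  candidate⁺ : ∀ {Γ Δ Θ} → (Γ , Δ) ∈ splits σ → Θ ∈ laters → (Γ ⊢ Δ ∣ Θ) ∈ candidates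
  candidate⁺ = ∈-cartesianProductWith⁺ (λ (Γ , Δ) Θ → Γ ⊢ Δ ∣ Θ)

  candidate⁻ : ∀ {s} → s ∈ candidates → (ante s , succ s) ∈ splits σ × later s ∈ laters
  candidate⁻ m with _ , _ , m₁ , m₂ , refl ← ∈-cartesianProductWith⁻ _ (splits σ) laters m = m₁ , m₂

  module Step (L : List Sequent) (remaining : ∀ {t} → t ∈ candidates → t ∈ L ⊎ Valid t) where

    -- Replaces Lindenbaum's lemma. If no sequent of `L` extends `s`, every split of `σ` extending
    -- `s` has been deleted, hence is valid, and cutting on all of `σ` makes `s` valid.
    extension : ∀ s → ante s ⊆ σ → succ s ⊆ σ → later s ∈ laters → Any (Extends s) L ⊎ Valid s
    extension s Γ⊆ Δ⊆ Θ∈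
      with any? (λ t → (ante s ⊆? ante t) ×-dec (succ s ⊆? succ t) ×-dec ≡-dec _≟_ (later s) (later t)) L
    ... | yes ext = inj₁ ext
    ... | no ¬ext = inj₂ λ F V w ⊨Γ → cut σ λ m ⊨l →
      -- A split that does not extend `s` is harmless: a true antecedent formula lies in `r`, or a
      -- succedent formula lies in `l` and is true.
      let Γ⊆l = all-or (ante s) λ {φ} φ∈ →
                  Sum.map₂ (λ φ∈r → lose φ∈r (All.lookup ⊨Γ φ∈)) (splits-cover σ m (Γ⊆ φ∈))
          Δ⊆r = all-or (succ s) λ {φ} φ∈ →
                  Sum.swap (Sum.map₁ (λ φ∈l → lose φ∈ (All.lookup ⊨l φ∈l)) (splits-cover σ m (Δ⊆ φ∈)))
      in conclude F V w m ⊨l Γ⊆l Δ⊆r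
      where
      conclude : ∀ F V w {l r} → (l , r) ∈ splits σ → All (Sat (frame F) V w) l →
        All (_∈ l) (ante s) ⊎ Any (Sat (frame F) V w) r →
        All (_∈ r) (succ s) ⊎ Any (Sat (frame F) V w) (succ s) →
        Any (Sat (frame F) V w) r ⊎
          (Any (Sat (frame F) V w) (succ s) ⊎ MAny (Sat (frame F) V w ∘ ◇) (later s))
      conclude F V w m ⊨l (inj₂ ⊨r)  _           = inj₁ ⊨r
      conclude F V w m ⊨l (inj₁ Γ⊆l) (inj₂ ⊨Δ)   = inj₂ (inj₁ ⊨Δ)
      conclude F V w m ⊨l (inj₁ Γ⊆l) (inj₁ Δ⊆r) with remaining (candidate⁺ m Θ∈)
      ... | inj₁ t∈L = contradiction (lose t∈L ((λ {_} → All.lookup Γ⊆l) , (λ {_} → All.lookup Δ⊆r) , refl)) ¬ext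
      ... | inj₂ val = Sum.map₂ inj₂ (val F V w ⊨l)

    module _ {s : Sequent} (s∈ : s ∈ candidates) where

      private
        Γ = ante s
        Δ = succ s

      Γ⊆σ : Γ ⊆ σ
      Γ⊆σ = proj₁ (splits-⊆ σ (proj₁ (candidate⁻ s∈)))

      Δ⊆σ : Δ ⊆ σ
      Δ⊆σ = proj₂ (splits-⊆ σ (proj₁ (candidate⁻ s∈)))

      cover : φ ∈ σ → φ ∈ Γ ⊎ φ ∈ Δ
      cover = splits-cover σ (proj₁ (candidate⁻ s∈))

      persistents⊆σ : persistents Γ ⊆ σ
      persistents⊆σ = Γ⊆σ ∘ filter-⊆ persistent? Γ

      entails : φ ∈ Γ → ψ ∈ Δ →
        (∀ (F : CS4Frame) V w → Sat (frame F) V w φ → Sat (frame F) V w ψ) → Valid s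
      entails φ∈ ψ∈ f F V w ⊨Γ = inj₁ (lose ψ∈ (f F V w (All.lookup ⊨Γ φ∈)))

      provable : φ ∈ Δ →
        (∀ (F : CS4Frame) V w → All (Sat (frame F) V w) Γ → Sat (frame F) V w φ) → Valid s
      provable φ∈ f F V w ⊨Γ = inj₁ (lose φ∈ (f F V w ⊨Γ))

      check-forced : ∀ φ → φ ∈ Γ → Forced L s φ ⊎ Valid s
      check-forced (var n) m = inj₁ tt
      check-forced ⊥'      m = inj₁ tt
      check-forced (φ ∧ ψ) m
        with cover (closed (Γ⊆σ m) (here refl)) | cover (closed (Γ⊆σ m) (there (here refl)))
      ... | inj₁ x | inj₁ y = inj₁ (x , y)
      ... | inj₂ x | _      = inj₂ (entails m x λ _ _ _ → proj₁)
      ... | _      | inj₂ y = inj₂ (entails m y λ _ _ _ → proj₂)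
      check-forced (φ ∨ ψ) m
        with cover (closed (Γ⊆σ m) (here refl)) | cover (closed (Γ⊆σ m) (there (here refl)))
      ... | inj₁ x | _      = inj₁ (inj₁ x)
      ... | _      | inj₁ y = inj₁ (inj₂ y)
      ... | inj₂ x | inj₂ y = inj₂ λ F V w ⊨Γ → inj₁ ([ lose x , lose y ]′ (All.lookup ⊨Γ m))
      check-forced (φ ⇒ ψ) m
        with cover (closed (Γ⊆σ m) (here refl)) | cover (closed (Γ⊆σ m) (there (here refl)))
      ... | inj₂ x | _      = inj₁ (inj₁ x)
      ... | _      | inj₁ y = inj₁ (inj₂ y)
      ... | inj₁ x | inj₂ y = inj₂ λ F V w ⊨Γ →
        inj₁ (lose y (All.lookup ⊨Γ m w (≼-refl (frame F)) (All.lookup ⊨Γ x)))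
      check-forced (◇ φ) m
        with extension (φ ∷ persistents Γ ⊢ [] ∣ later s)
               (∈-∷⁺ʳ (closed (Γ⊆σ m) (here refl)) persistents⊆σ) (λ ()) (proj₂ (candidate⁻ s∈))
      ... | inj₁ ext = inj₁ (Any.map (λ (p , _ , e) → ((λ {_} → p ∘ there) , inj₂ e) , p (here refl)) ext)
      -- Validity with empty succedent yields ◇Θ at the φ-successor `v` of each `u` above `w`, and
      -- transitivity returns it to `w`.
      ... | inj₂ val = inj₂ λ F V w ⊨Γ → inj₂ (◇-transitive V λ u w≼u →
        let v , u⊑v , ⊨φ = All.lookup ⊨Γ m u w≼u
            ⊨per = Sat-persistents-⊑ V (backUpConf F) u⊑v Γ (All-Sat-≼ V w≼u ⊨Γ)
        in v , u⊑v , [ (λ ()) , id ]′ (val F V v (⊨φ ∷ ⊨per)))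
      check-forced (□ φ) m with cover (closed (Γ⊆σ m) (here refl))
      ... | inj₁ x = inj₁ x
      ... | inj₂ x = inj₂ (entails m x λ F V w ⊨□ → ⊨□ w w (≼-refl (frame F)) (⊑-refl (frame F)))

      check-refuted : ∀ φ → φ ∈ Δ → Refuted L s φ ⊎ Valid s
      check-refuted (var n) m = inj₁ tt
      check-refuted ⊥'      m = inj₁ tt
      check-refuted (φ ∧ ψ) m
        with cover (closed (Δ⊆σ m) (here refl)) | cover (closed (Δ⊆σ m) (there (here refl)))
      ... | inj₂ x | _      = inj₁ (inj₁ x)
      ... | _      | inj₂ y = inj₁ (inj₂ y)
      ... | inj₁ x | inj₁ y = inj₂ (provable m λ _ _ _ ⊨Γ → All.lookup ⊨Γ x , All.lookup ⊨Γ y)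
      check-refuted (φ ∨ ψ) m
        with cover (closed (Δ⊆σ m) (here refl)) | cover (closed (Δ⊆σ m) (there (here refl)))
      ... | inj₂ x | inj₂ y = inj₁ (x , y)
      ... | inj₁ x | _      = inj₂ (entails x m λ _ _ _ → inj₁)
      ... | _      | inj₁ y = inj₂ (entails y m λ _ _ _ → inj₂)
      check-refuted (φ ⇒ ψ) m
        -- Neither Δ nor Θ is kept: their truth at a world above `w` need not descend to `w`.
        with extension (φ ∷ Γ ⊢ ψ ∷ [] ∣ nothing)
               (∈-∷⁺ʳ (closed (Δ⊆σ m) (here refl)) Γ⊆σ)
               (∈-∷⁺ʳ (closed (Δ⊆σ m) (there (here refl))) λ ()) (here refl)
      ... | inj₁ ext = inj₁ (Any.map (λ (p , q , _) → (λ {_} → p ∘ there) , p (here refl) , q (here refl)) ext)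
      ... | inj₂ val = inj₂ (provable m λ F V w ⊨Γ v w≼v ⊨φ →
        conclusion (val F V v (⊨φ ∷ All-Sat-≼ V w≼v ⊨Γ)))
        where
        conclusion : ∀ {P Q : Form → Set} → Any P (ψ ∷ []) ⊎ MAny Q nothing → P ψ
        conclusion (inj₁ (here p)) = p
      check-refuted (◇ φ) m
        -- The interpretation of this sequent is exactly that Γ entails ◇φ.
        with extension (Γ ⊢ [] ∣ just φ) Γ⊆σ (λ ())
               (there (∈-map⁺ just (closed (Δ⊆σ m) (here refl))))
      ... | inj₁ ext = inj₁ (Any.map (λ (p , _ , e) → (λ {_} → p) , sym e) ext)
      ... | inj₂ val = inj₂ (provable m λ F V w ⊨Γ → conclusion (val F V w ⊨Γ))
        where
        conclusion : ∀ {P Q : Form → Set} → Any P [] ⊎ MAny Q (just φ) → Q φ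
        conclusion (inj₂ (just q)) = q
      check-refuted (□ φ) m
        with extension (persistents Γ ⊢ φ ∷ [] ∣ nothing) persistents⊆σ
               (∈-∷⁺ʳ (closed (Δ⊆σ m) (here refl)) λ ()) (here refl)
      ... | inj₁ ext = inj₁ (Any.map (λ (p , q , _) → (λ {_} → p) , q (here refl)) ext)
      ... | inj₂ val = inj₂ (provable m λ F V w ⊨Γ u v w≼u u⊑v →
        conclusion (val F V v
          (Sat-persistents-⊑ V (backUpConf F) u⊑v Γ (All-Sat-≼ V w≼u ⊨Γ))))
        where
        conclusion : ∀ {P Q : Form → Set} → Any P (φ ∷ []) ⊎ MAny Q nothing → P φ
        conclusion (inj₁ (here p)) = p

      -- Serves `disjoint` with `ψ` equal to `φ`, and `infallible` with ⊥, since fallible worlds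
      -- satisfy every formula.
      check-∉ : ∀ ψ → φ ∈ Δ →
        (∀ (F : CS4Frame) V w → Sat (frame F) V w ψ → Sat (frame F) V w φ) → ψ ∉ Γ ⊎ Valid s
      check-∉ ψ m f with any? (ψ ≟_) Γ
      ... | no ∉Γ  = inj₁ ∉Γ
      ... | yes ∈Γ = inj₂ (entails ∈Γ m f)

      -- If θ is in Γ instead, it persists along `≼`, and reflexivity of `⊑` gives ◇θ.
      check-later : (∀ {φ} → later s ≡ just φ → φ ∈ Δ) ⊎ Valid s
      check-later with later s | proj₂ (candidate⁻ s∈)
      ... | nothing | _ = inj₁ λ ()
      ... | just θ  | there m
        with ∈-map⁻ just m
      ... | _ , θ∈σ , refl with cover θ∈σ
      ...   | inj₂ x = inj₁ λ { refl → x }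
      ...   | inj₁ x = inj₂ λ F V w ⊨Γ → inj₂ (just λ u w≼u →
        u , ⊑-refl (frame F) , Sat-≼ V θ w≼u (All.lookup ⊨Γ x))

      check-base : (Γ ⊢ Δ ∣ nothing) ∈ L ⊎ Valid s
      check-base with remaining (candidate⁺ (proj₁ (candidate⁻ s∈)) (here refl))
      ... | inj₁ b   = inj₁ b
      ... | inj₂ val = inj₂ λ F V w ⊨Γ → inj₁ ([ id , (λ ()) ]′ (val F V w ⊨Γ))

      check : Good L s ⊎ Valid s
      check
        with all-or Γ (λ {φ} → check-forced φ)
           | all-or Δ (λ {φ} → check-refuted φ)
           | all-or Δ (λ {φ} m → check-∉ φ m λ _ _ _ → id)
           | all-or Δ (λ {φ} m → check-∉ ⊥' m λ _ V _ → Sat-Fall V φ)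
           | check-later
           | check-base
      ... | inj₂ v | _ | _ | _ | _ | _ = inj₂ v
      ... | _ | inj₂ v | _ | _ | _ | _ = inj₂ v
      ... | _ | _ | inj₂ v | _ | _ | _ = inj₂ v
      ... | _ | _ | _ | inj₂ v | _ | _ = inj₂ v
      ... | _ | _ | _ | _ | inj₂ v | _ = inj₂ v
      ... | _ | _ | _ | _ | _ | inj₂ v = inj₂ v
      ... | inj₁ f | inj₁ r | inj₁ d | inj₁ i | inj₁ l | inj₁ b = inj₁ record
        { forced = f ; refuted = r ; disjoint = d ; infallible = i ; later-succ = l ; base = b }

  record Saturated : Set₁ where
    field
      worlds    : List Sequent
      ⊆cands    : worlds ⊆ candidates
      remaining : ∀ {t} → t ∈ candidates → t ∈ worlds ⊎ Valid t
      good      : All (Good worlds) worlds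

  -- `Good` depends on `L`, so a deletion can remove a witness used elsewhere and the check must be
  -- repeated; `n` bounds the remaining rounds.
  saturate : ∀ n L → length L ≤ n → L ⊆ candidates →
    (∀ {t} → t ∈ candidates → t ∈ L ⊎ Valid t) → Saturated
  saturate n L len L⊆ rem with all-or-shrink L (λ m → Step.check L rem (L⊆ m))
  ... | inj₁ good = record { worlds = L ; ⊆cands = L⊆ ; remaining = rem ; good = good }
  saturate zero    L len L⊆ rem | inj₂ (L′ , lt , _) with () ← ≤-trans lt len
  saturate (suc n) L len L⊆ rem | inj₂ (L′ , lt , L′⊆ , rem′) with s≤s le ← ≤-trans lt len =
    saturate n L′ le (L⊆ ∘ L′⊆) λ m → [ rem′ , inj₂ ]′ (rem m)

  saturated : Saturated
  saturated = saturate _ candidates ≤-refl id inj₁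

  -- The finite model

  open Saturated saturated

  -- Worlds are positions in the list, so finiteness is witnessed by the identity bijection.
  World : Set
  World = Fin (length worlds)

  seq : World → Sequent
  seq = lookup worlds

  good-at : ∀ w → Good worlds (seq w)
  good-at w = All.lookup good (∈-lookup w)

  world : ∀ {P : Sequent → Set} → Any P worlds → ∃ λ w → P (seq w)
  world m = index m , lookup-index m

  model : BiIntFrame
  model .W = World
  model .Fall w = ⊥' ∈ ante (seq w)
  model ._≼_ w v = ante (seq w) ⊆ ante (seq v)
  model ._⊑_ w v = seq w ⊑ˢ seq v
  model .≼-refl = id
  model .≼-trans w⊆v v⊆u = v⊆u ∘ w⊆v
  model .⊑-refl {w} = filter-⊆ persistent? (ante (seq w)) , inj₂ refl
  model .⊑-trans {w} {v} {u} = ⊑ˢ-trans {seq w} {seq v} {seq u}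
  model .Fall-≼ w⊆v = w⊆v
  model .Fall-⊑ (p , _) m = p (∈-filter⁺ persistent? m falsum)

  -- Erasing Θ keeps the antecedent, so it stays above `w`, and lifts the constraint that Θ puts on
  -- `⊑`.
  base-world : ∀ w → ∃ λ w′ → _≼_ model w w′ ×
    (∀ v → persistents (ante (seq w)) ⊆ ante (seq v) → _⊑_ model w′ v)
  base-world w with w′ , eq ← world (Good.base (good-at w)) =
    w′ , (λ {_} → subst (λ t → _ ∈ ante t) eq) ,
    λ v p → subst (_⊑ˢ seq v) eq ((λ {_} → p) , inj₁ refl)

  model-confluent : BackUpConfluent model
  model-confluent {w} {_} {v′} (p , _) v⊆v′ with w′ , w≼w′ , below ← base-world w =
    w′ , (λ {_} → w≼w′) , below v′ (v⊆v′ ∘ p)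

  valuation : Valuation model
  -- The second disjunct makes variables true at fallible worlds, whose antecedent may omit them.
  valuation .val n w = var n ∈ ante (seq w) ⊎ ⊥' ∈ ante (seq w)
  valuation .val-≼ n w⊆v = Sum.map w⊆v w⊆v
  valuation .val-Fall n = inj₂

  -- Truth lemma

  ⊨_at_ : Form → World → Set
  ⊨ φ at w = Sat model valuation w φ

  -- Proved by induction on the formula together with `succ⇒¬Sat`, since the premise of an
  -- implication changes sides.
  ante⇒Sat : ∀ φ w → φ ∈ ante (seq w) → ⊨ φ at w
  succ⇒¬Sat : ∀ φ w → φ ∈ succ (seq w) → ¬ (⊨ φ at w)

  ante⇒Sat (var n) w m = inj₁ m
  ante⇒Sat ⊥' w m = m
  ante⇒Sat (φ ∧ ψ) w m with x , y ← All.lookup (Good.forced (good-at w)) m =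
    ante⇒Sat φ w x , ante⇒Sat ψ w y
  ante⇒Sat (φ ∨ ψ) w m =
    Sum.map (ante⇒Sat φ w) (ante⇒Sat ψ w) (All.lookup (Good.forced (good-at w)) m)
  ante⇒Sat (φ ⇒ ψ) w m v w⊆v ⊨φ with All.lookup (Good.forced (good-at v)) (w⊆v m)
  ... | inj₁ x = contradiction ⊨φ (succ⇒¬Sat φ v x)
  ... | inj₂ y = ante⇒Sat ψ v y
  ante⇒Sat (◇ φ) w m u w⊆u
    with v , u⊑v , x ← world (All.lookup (Good.forced (good-at u)) (w⊆u m)) =
    v , u⊑v , ante⇒Sat φ v x
  ante⇒Sat (□ φ) w m u v w⊆u (p , _) =
    ante⇒Sat φ v (All.lookup (Good.forced (good-at v)) (p (∈-filter⁺ persistent? (w⊆u m) box)))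

  succ⇒¬Sat (var n) w m (inj₁ x) = All.lookup (Good.disjoint (good-at w)) m x
  succ⇒¬Sat (var n) w m (inj₂ x) = All.lookup (Good.infallible (good-at w)) m x
  succ⇒¬Sat ⊥' w m x = All.lookup (Good.infallible (good-at w)) m x
  succ⇒¬Sat (φ ∧ ψ) w m (⊨φ , ⊨ψ) with All.lookup (Good.refuted (good-at w)) m
  ... | inj₁ x = succ⇒¬Sat φ w x ⊨φ
  ... | inj₂ y = succ⇒¬Sat ψ w y ⊨ψ
  succ⇒¬Sat (φ ∨ ψ) w m with x , y ← All.lookup (Good.refuted (good-at w)) m =
    [ succ⇒¬Sat φ w x , succ⇒¬Sat ψ w y ]′
  succ⇒¬Sat (φ ⇒ ψ) w m ⊨φψ
    with v , w⊆v , x , y ← world (All.lookup (Good.refuted (good-at w)) m) =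
    succ⇒¬Sat ψ v y (⊨φψ v w⊆v (ante⇒Sat φ v x))
  succ⇒¬Sat (◇ φ) w m ⊨◇φ
    with u , w⊆u , eq ← world (All.lookup (Good.refuted (good-at w)) m)
    with ⊨◇φ u w⊆u
  -- Since `later` of `u` is `just φ`, any successor `v` carries it too, and `later-succ` refutes φ
  -- at `v`.
  ... | v , (_ , inj₁ none) , ⊨φ with () ← trans (sym eq) none
  ... | v , (_ , inj₂ same) , ⊨φ =
    succ⇒¬Sat φ v (Good.later-succ (good-at v) (trans (sym same) eq)) ⊨φ
  succ⇒¬Sat (□ φ) w m ⊨□φ
    with v , p , x ← world (All.lookup (Good.refuted (good-at w)) m)
    -- The `later` of `w` could block `v`; the semantics of □ allows a first step up to the base
    -- world, which sees `v`.
    with u , w≼u , below ← base-world w =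
    succ⇒¬Sat φ v x (⊨□φ u v w≼u (below v p))

  -- Empty Γ serves falsifiability; Γ consisting of one formula, with ⊥ on the right, serves
  -- satisfiability.
  valid-or-refuted : ∀ {Γ φ} → Γ ⊆ σ → φ ∈ σ → Valid (Γ ⊢ φ ∷ [] ∣ nothing) ⊎
    Σ CS4Frame λ G → Finite (frame G) × Σ (Valuation (frame G)) λ V → Σ (W (frame G)) λ w →
      ¬ Fall (frame G) w × All (Sat (frame G) V w) Γ × ¬ Sat (frame G) V w φ
  valid-or-refuted {Γ} {φ} Γ⊆ φ∈
    with Step.extension worlds remaining (Γ ⊢ φ ∷ [] ∣ nothing) Γ⊆ (∈-∷⁺ʳ φ∈ λ ()) (here refl)
  ... | inj₂ val = inj₁ val
  ... | inj₁ ext with w , p , q , _ ← world ext =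
    inj₂ (record { frame = model ; backUpConf = model-confluent } , (_ , ↔-id _) , valuation , w ,
          All.lookup (Good.infallible (good-at w)) (q (here refl)) ,
          All.tabulate (λ {ψ} m → ante⇒Sat ψ w (p m)) , succ⇒¬Sat φ w (q (here refl)))

-- The finite frame property

open Elimination using (valid-or-refuted)

mainTheorem1 : (φ : Form) →
    ((Σ CS4Frame λ F → Falsifiable (frame F) φ) →
    Σ CS4Frame λ G → Finite (frame G) × Falsifiable (frame G) φ)
    × ((Σ CS4Frame λ F → Satisfiable (frame F) φ) →
    Σ CS4Frame λ G → Finite (frame G) × Satisfiable (frame G) φ)
mainTheorem1 φ = falsify , satisfy
  where
  falsify : (Σ CS4Frame λ F → Falsifiable (frame F) φ) →
    Σ CS4Frame λ G → Finite (frame G) × Falsifiable (frame G) φ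
  falsify (F , V , w , _ , ⊭φ)
    with valid-or-refuted _ (subformulas-closed φ) {Γ = []} (λ ()) (∈-subformulas φ)
  ... | inj₂ (G , fin , V′ , v , nf , _ , ⊭) = G , fin , V′ , v , nf , ⊭
  ... | inj₁ val with inj₁ (here ⊨φ) ← val F V w [] = contradiction ⊨φ ⊭φ

  satisfy : (Σ CS4Frame λ F → Satisfiable (frame F) φ) →
    Σ CS4Frame λ G → Finite (frame G) × Satisfiable (frame G) φ
  satisfy (F , V , w , nf , ⊨φ)
    -- Subformulas of φ → ⊥ include both sides of the sequent φ ⊢ ⊥, which the given infallible
    -- world prevents from being valid.
    with valid-or-refuted _ (subformulas-closed (φ ⇒ ⊥')) {Γ = φ ∷ []}
           (∈-∷⁺ʳ (there (operands⊆ φ ⊥' (here refl))) λ ())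
           (there (operands⊆ φ ⊥' (there (here refl))))
  ... | inj₂ (G , fin , V′ , v , nf′ , ⊨ ∷ [] , _) = G , fin , V′ , v , nf′ , ⊨
  ... | inj₁ val with inj₁ (here f) ← val F V w (⊨φ ∷ []) = contradiction f nf
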